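{- For every integer $k$ and every integer $n\geq 1$, \[ b_{n}^{(k)}(x+1)-b_{n}^{(k)}(x)=\sum_{p=1}^{n}\sum_{m=1}^{p}\binom{n}{p}\frac{(-1)^{m+p}\,m!}{m^{k}}S_{2}(p,m)\,b_{n-p}(x). \]
   Context: For $k\in\mathbb{Z}$, the polylogarithm is $Li_k(x)=\sum_{n=1}^{\infty}\frac{x^n}{n^k}$. The poly-Bernoulli polynomials of the second kind $b_n^{(k)}(x)$ are defined by the generating function \[ \frac{Li_{k}(1-e^{ -t})}{\log(1+t)}(1+t)^{x}=\sum_{n=0}^{\infty}b_{n}^{(k)}(x)\frac{t^{n}}{n!}. \] The Bernoulli polynomials of the second kind $b_n(x)$ are defined by $\frac{t}{\log(1+t)}(1+t)^x=\sum_{n=0}^{\infty}b_n(x)\frac{t^n}{n!}$. $S_2(n,l)$ denotes the Stirling numbers of the second kind, defined by $x^n=\sum_{l=0}^{n}S_2(n,l)(x)_l$, where $(x)_l=x(x-1)\cdots(x-l+1)$. -}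

module Defs where

open import Algebra.Bundles using (CommutativeRing)
import Algebra.Definitions.RawMonoid
open import Algebra.Morphism.Structures using (IsRingHomomorphism)
import Algebra.Properties.Semiring.Exp
import Algebra.Properties.Semiring.Sum
open import Data.Fin.Base using (toℕ)
open import Data.Integer.Base as ℤ using (ℤ; -[1+_])
open import Data.Nat.Base as ℕ using (ℕ; zero; suc; _∸_; _!; NonZero; s≤s)
open import Data.Nat.Properties using (_!≢0; m^n≢0; n<1+n; m<n⇒m<1+n)
open import Data.Rational.Base as ℚ using (ℚ)
import Data.Rational.Properties as ℚₚ
open import Data.Rational.Solver using (module +-*-Solver)
open import Level using (Level; _⊔_) renaming (suc to lsuc)
open import Relation.Binary.PropositionalEquality

ℚ-ring : CommutativeRing _ _
ℚ-ring = ℚₚ.+-*-commutativeRing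

module RingNotation {c ℓ} (R : CommutativeRing c ℓ) where
  open CommutativeRing R
  open Algebra.Properties.Semiring.Sum semiring public
  open Algebra.Properties.Semiring.Exp semiring public using (_^_)
  open Algebra.Definitions.RawMonoid +-rawMonoid public using (_×_)

  infixr 5 sum₀ sum₁

  sum₀ : ℕ → (ℕ → Carrier) → Carrier
  sum₀ n f = ∑[ i ≤ n ] f (toℕ i)

  sum₁ : ∀ n → ((m : ℕ) → .{{NonZero m}} → Carrier) → Carrier
  sum₁ n f = ∑[ i < n ] f (suc (toℕ i))

  syntax sum₀ n (λ i → x) = ∑[ i from0to n ] x
  syntax sum₁ n (λ i → x) = ∑[ i from1to n ] x

  fallingFactorial : Carrier → ℕ → Carrier
  fallingFactorial x zero    = 1#
  fallingFactorial x (suc l) = fallingFactorial x l * (x - l × 1#)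

-- Formal power series in t, given by their coefficients.
module PowerSeries {c ℓ} (R : CommutativeRing c ℓ) where
  open CommutativeRing R
  open RingNotation R

  Series : Set c
  Series = ℕ → Carrier

  𝟙 : Series
  𝟙 zero    = 1#
  𝟙 (suc _) = 0#

  𝕥 : Series
  𝕥 zero    = 0#
  𝕥 (suc n) = 𝟙 n

  infixl 6 _⊖_
  infixl 7 _⊛_ _⊘_
  infixr 8 _⊛^_
  infixr 9 _⟨_⟩

  _⊖_ : Series → Series → Series
  (F ⊖ G) n = F n - G n

  _⊛_ : Series → Series → Series
  (F ⊛ G) n = ∑[ i from0to n ] F i * G (n ∸ i)

  _⊛^_ : Series → ℕ → Series
  F ⊛^ zero  = 𝟙
  F ⊛^ suc n = F ⊛ F ⊛^ n

  -- Composition Σᵢ Fᵢ Gⁱ, meaningful only when G has zero constant term: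
  -- then Gⁱ does not contribute to the coefficient of tⁿ for i > n.
  _⟨_⟩ : Series → Series → Series
  (F ⟨ G ⟩) n = ∑[ i from0to n ] F i * (G ⊛^ i) n

  -- F⁻¹ = Σᵢ (1 - F)ⁱ, meaningful only when F has constant term 1.
  recip : Series → Series
  recip F = (λ _ → 1#) ⟨ 𝟙 ⊖ F ⟩

  -- F / t, meaningful only when F has zero constant term.
  _/𝕥 : Series → Series
  (F /𝕥) n = F (suc n)

  -- F / G = (F / t) · (G / t)⁻¹, meaningful only when F = O(t) and
  -- G = t + O(t²).
  _⊘_ : Series → Series → Series
  F ⊘ G = (F /𝕥) ⊛ recip (G /𝕥)

-- m⁻ᵏ for an integer exponent k of either sign
infix 8 1/_^_
1/_^_ : (m : ℕ) .{{_ : NonZero m}} → ℤ → ℚ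
1/ m ^ (ℤ.+ k)  = (ℤ.+ 1 ℚ./ (m ℕ.^ k)) {{m^n≢0 m k}}
1/ m ^ -[1+ k ] = ℤ.+ (m ℕ.^ suc k) ℚ./ 1

ℕ→ℚ : ℕ → ℚ
ℕ→ℚ n = ℤ.+ n ℚ./ 1

1/_! : ℕ → ℚ
1/ n ! = (ℤ.+ 1 ℚ./ (n !)) {{n !≢0}}

sign : ℕ → ℚ
sign n = (ℚ.- ℚ.1ℚ) ^ n
  where open RingNotation ℚ-ring

-- A polynomial identity over ℚ in the indeterminate x is the same thing as
-- an identity valid for every element x of every commutative ℚ-algebra
-- (ℚ[X], ℝ and ℂ included).
record ℚ-Algebra (c ℓ : Level) : Set (lsuc (c ⊔ ℓ)) where
  field
    commutativeRing : CommutativeRing c ℓ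
  open CommutativeRing commutativeRing public
  field
    ι : ℚ → Carrier
    ι-isRingHomomorphism :
      IsRingHomomorphism (CommutativeRing.rawRing ℚ-ring) rawRing ι

module PolyBernoulli {c ℓ} (A : ℚ-Algebra c ℓ) where
  open ℚ-Algebra A public
  open RingNotation commutativeRing public
  open PowerSeries commutativeRing public

  Li : ℤ → Series
  Li k zero      = 0#
  Li k n@(suc _) = ι (1/ n ^ k)

  exp[-t] : Series
  exp[-t] n = ι (sign n ℚ.* 1/ n !)

  log[1+t] : Series
  log[1+t] zero      = 0#
  log[1+t] n@(suc m) = ι (sign m ℚ.* 1/ n ^ ℤ.1ℤ)

  [1+t]^_ : Carrier → Series
  ([1+t]^ x) n = ι (1/ n !) * fallingFactorial x n

  -- The sequence a with F = Σₙ aₙ tⁿ/n!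
  egfCoefficient : Series → ℕ → Carrier
  egfCoefficient F n = ι (ℕ→ℚ (n !)) * F n

  bernoulli₂ : ℕ → Carrier → Carrier
  bernoulli₂ n x = egfCoefficient (𝕥 ⊘ log[1+t] ⊛ [1+t]^ x) n

  polyBernoulli₂ : ℤ → ℕ → Carrier → Carrier
  polyBernoulli₂ k n x =
    egfCoefficient (Li k ⟨ 𝟙 ⊖ exp[-t] ⟩ ⊘ log[1+t] ⊛ [1+t]^ x) n

module _ where
  open RingNotation ℚ-ring
  open +-*-Solver using (solve; con; _:+_; _:-_; _:*_; _:=_)
  open import Data.Rational.Base using (0ℚ; 1ℚ; _+_; _*_)

  IsStirling₂ : (ℕ → ℕ → ℚ) → Set
  IsStirling₂ S₂ = ∀ n (x : ℚ) →
    x ^ n ≡ ∑[ l from0to n ] S₂ n l * fallingFactorial x l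

  -- IsStirling₂ determines S₂ n l for l ≤ n, the only values that matter;
  -- the rest of this module shows that it is satisfiable.

  stirling₂ : ℕ → ℕ → ℚ
  stirling₂ zero    zero    = 1ℚ
  stirling₂ zero    (suc l) = 0ℚ
  stirling₂ (suc n) zero    = 0ℚ
  stirling₂ (suc n) (suc l) = stirling₂ n l + (suc l × 1ℚ) * stirling₂ n (suc l)

  private
    open ≡-Reasoning

    stirling₂-zero : ∀ n l → n ℕ.< l → stirling₂ n l ≡ 0ℚ
    stirling₂-zero zero    (suc l) _         = refl
    stirling₂-zero (suc n) (suc l) (s≤s n<l) = begin
      stirling₂ n l + (suc l × 1ℚ) * stirling₂ n (suc l)
        ≡⟨ cong₂ (λ a b → a + (suc l × 1ℚ) * b)
                 (stirling₂-zero n l n<l) (stirling₂-zero n (suc l) (m<n⇒m<1+n n<l)) ⟩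
      0ℚ + (suc l × 1ℚ) * 0ℚ
        ≡⟨ trans (ℚₚ.+-identityˡ _) (ℚₚ.*-zeroʳ (suc l × 1ℚ)) ⟩
      0ℚ ∎

    sum₀-cong : ∀ n {f g : ℕ → ℚ} → (∀ i → f i ≡ g i) → sum₀ n f ≡ sum₀ n g
    sum₀-cong n f≗g = sum-cong-≗ {suc n} (λ i → f≗g (toℕ i))

    sum₀-distribˡ : ∀ n x (f : ℕ → ℚ) → x * sum₀ n f ≡ sum₀ n (λ i → x * f i)
    sum₀-distribˡ n x f = *-distribˡ-sum {suc n} x (λ i → f (toℕ i))

    sum₀-+ : ∀ n (f g : ℕ → ℚ) → sum₀ n (λ i → f i + g i) ≡ sum₀ n f + sum₀ n g
    sum₀-+ n f g = ∑-distrib-+ {suc n} (λ i → f (toℕ i)) (λ i → g (toℕ i))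

    sum₀-last : ∀ n (f : ℕ → ℚ) → sum₀ (suc n) f ≡ sum₀ n f + f (suc n)
    sum₀-last zero    f =
      solve 2 (λ a b → a :+ (b :+ con 0ℚ) := (a :+ con 0ℚ) :+ b) refl (f 0) (f 1)
    sum₀-last (suc n) f = trans
      (cong (f 0 +_) (sum₀-last n (λ i → f (suc i))))
      (sym (ℚₚ.+-assoc (f 0) _ _))

  stirling₂-isStirling₂ : IsStirling₂ stirling₂
  stirling₂-isStirling₂ zero    x = refl
  stirling₂-isStirling₂ (suc n) x = begin
    x * x ^ n
      ≡⟨ cong (x *_) (stirling₂-isStirling₂ n x) ⟩
    x * sum₀ n (λ l → S n l * x⟨ l ⟩)
      ≡⟨ sum₀-distribˡ n x (λ l → S n l * x⟨ l ⟩) ⟩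
    sum₀ n (λ l → x * (S n l * x⟨ l ⟩))
      ≡⟨ sum₀-cong n (λ l → solve 4
           (λ x s p l → x :* (s :* p) := s :* (p :* (x :- l)) :+ l :* s :* p)
           refl x (S n l) x⟨ l ⟩ (l × 1ℚ)) ⟩
    sum₀ n (λ l → S n l * x⟨ suc l ⟩ + h l)
      ≡⟨ sum₀-+ n (λ l → S n l * x⟨ suc l ⟩) h ⟩
    sum₀ n (λ l → S n l * x⟨ suc l ⟩) + sum₀ n h
      ≡⟨ cong (sum₀ n (λ l → S n l * x⟨ suc l ⟩) +_) shift-h ⟩
    sum₀ n (λ l → S n l * x⟨ suc l ⟩) + sum₀ n (λ l → h (suc l))
      ≡⟨ sum₀-+ n (λ l → S n l * x⟨ suc l ⟩) (λ l → h (suc l)) ⟨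
    sum₀ n (λ l → S n l * x⟨ suc l ⟩ + h (suc l))
      ≡⟨ sum₀-cong n (λ l → ℚₚ.*-distribʳ-+ x⟨ suc l ⟩ (S n l) ((suc l × 1ℚ) * S n (suc l))) ⟨
    sum₀ n (λ l → S (suc n) (suc l) * x⟨ suc l ⟩)
      ≡⟨ ℚₚ.+-identityˡ _ ⟨
    sum₀ (suc n) (λ l → S (suc n) l * x⟨ l ⟩) ∎
    where
    S     = stirling₂
    x⟨_⟩  = fallingFactorial x

    h : ℕ → ℚ
    h l = (l × 1ℚ) * S n l * x⟨ l ⟩

    h₀ : h 0 ≡ 0ℚ
    h₀ = solve 2 (λ s p → con 0ℚ :* s :* p := con 0ℚ) refl (S n 0) x⟨ 0 ⟩

    hₙ₊₁ : h (suc n) ≡ 0ℚ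
    hₙ₊₁ = trans
      (cong (λ s → (suc n × 1ℚ) * s * x⟨ suc n ⟩) (stirling₂-zero n (suc n) (n<1+n n)))
      (solve 2 (λ l p → l :* con 0ℚ :* p := con 0ℚ) refl (suc n × 1ℚ) x⟨ suc n ⟩)

    shift-h : sum₀ n h ≡ sum₀ n (λ l → h (suc l))
    shift-h = begin
      sum₀ n h                          ≡⟨ ℚₚ.+-identityʳ _ ⟨
      sum₀ n h + 0ℚ                     ≡⟨ cong (sum₀ n h +_) hₙ₊₁ ⟨
      sum₀ n h + h (suc n)              ≡⟨ sum₀-last n h ⟨
      h 0 + sum₀ n (λ l → h (suc l))    ≡⟨ cong (_+ sum₀ n (λ l → h (suc l))) h₀ ⟩
      0ℚ + sum₀ n (λ l → h (suc l))     ≡⟨ ℚₚ.+-identityˡ _ ⟩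
      sum₀ n (λ l → h (suc l))          ∎

{-# OPTIONS --safe #-}

-- Since (1+t)ˣ⁺¹ - (1+t)ˣ = t (1+t)ˣ, the difference on the left-hand side has
-- generating function Liₖ(u) · t/log(1+t) · (1+t)ˣ with u = 1 - e⁻ᵗ, so the
-- theorem is the product rule for exponential generating functions once
-- uᵐ = Σₚ (-1)ᵐ⁺ᵖ m! S₂(p,m) tᵖ/p! is known.  As u′ = 1 - u, the powers satisfy
-- (uᵐ⁺¹)′ = (m+1)(uᵐ - uᵐ⁺¹), which is the Stirling recurrence up to signs.
-- An arbitrary S₂ is compared with the recursive one by taking differences of
-- Newton expansions; this yields l! S₂ n l, and only that product occurs.
module Submission where

open import Defs
open import Algebra.Bundles using (CommutativeRing)
open import Algebra.Morphism.Structures using (IsRingHomomorphism)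
import Algebra.Properties.CommutativeSemigroup
import Algebra.Properties.Ring
import Algebra.Properties.Semiring.Mult
import Algebra.Solver.Ring.NaturalCoefficients.Default as NaturalCoefficients
open import Data.Fin.Base using (toℕ)
open import Data.Fin.Properties using (toℕ<n; toℕ≤pred[n])
open import Data.Integer.Base as ℤ using (ℤ)
import Data.Integer.Properties as ℤₚ
open import Data.Nat.Base using (ℕ; zero; suc; NonZero; _∸_; _≤_; _!; z≤n; s≤s)
  renaming (_+_ to _+ℕ_; _*_ to _*ℕ_)
open import Data.Nat.Combinatorics using (_C_; nCk≡n!/k![n-k]!; k![n∸k]!∣n!)
open import Data.Nat.DivMod using (m/n*n≡m)
import Data.Nat.Properties as ℕₚ
open import Data.Rational.Base as ℚ using (ℚ; 0ℚ; 1ℚ; fromℚᵘ)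
  renaming (_+_ to _+ℚ_; _*_ to _*ℚ_; _-_ to _-ℚ_; -_ to -ℚ_)
import Data.Rational.Properties as ℚₚ
open import Data.Rational.Solver using (module +-*-Solver)
open import Data.Rational.Unnormalised.Base as ℚᵘ using (mkℚᵘ; *≡*)
import Data.Rational.Unnormalised.Properties as ℚᵘₚ
open import Relation.Binary.PropositionalEquality as ≡ using (_≡_; cong; cong₂)
import Relation.Binary.Reasoning.Setoid

-- Formal power series: the Cauchy product, powers and the derivation `θ`.

module PowerSeriesProperties {c ℓ} (R : CommutativeRing c ℓ) where
  open CommutativeRing R
  open RingNotation R
  open PowerSeries R
  open Algebra.Properties.CommutativeSemigroup *-commutativeSemigroup using (x∙yz≈y∙xz)
  open Algebra.Properties.Ring ring using (-1*x≈-x)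
  open Algebra.Properties.Semiring.Mult semiring using (×-homo-+)
  open NaturalCoefficients commutativeSemiring using (solve; con; _:+_; _:*_; _:=_)
  open Relation.Binary.Reasoning.Setoid setoid

  sum₀-cong-≤ : ∀ n {f g : ℕ → Carrier} → (∀ i → i ≤ n → f i ≈ g i) → sum₀ n f ≈ sum₀ n g
  sum₀-cong-≤ n f≈g = sum-cong-≋ {suc n} (λ i → f≈g (toℕ i) (toℕ≤pred[n] i))

  sum₀-cong : ∀ n {f g : ℕ → Carrier} → (∀ i → f i ≈ g i) → sum₀ n f ≈ sum₀ n g
  sum₀-cong n f≈g = sum₀-cong-≤ n (λ i _ → f≈g i)

  sum₀-distribˡ : ∀ n x (f : ℕ → Carrier) → x * sum₀ n f ≈ sum₀ n (λ i → x * f i)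
  sum₀-distribˡ n x f = *-distribˡ-sum {suc n} x (λ i → f (toℕ i))

  sum₀-+ : ∀ n (f g : ℕ → Carrier) → sum₀ n (λ i → f i + g i) ≈ sum₀ n f + sum₀ n g
  sum₀-+ n f g = ∑-distrib-+ {suc n} (λ i → f (toℕ i)) (λ i → g (toℕ i))

  ⊛-cong : ∀ {F F′ G G′ : Series} → (∀ i → F i ≈ F′ i) → (∀ i → G i ≈ G′ i) →
           ∀ n → (F ⊛ G) n ≈ (F′ ⊛ G′) n
  ⊛-cong F≈F′ G≈G′ n = sum₀-cong n (λ i → *-cong (F≈F′ i) (G≈G′ (n ∸ i)))

  ⊛-congˡ : ∀ F {G G′ : Series} → (∀ i → G i ≈ G′ i) → ∀ n → (F ⊛ G) n ≈ (F ⊛ G′) n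
  ⊛-congˡ F = ⊛-cong {F = F} (λ _ → refl)

  ⊛-congʳ : ∀ G {F F′ : Series} → (∀ i → F i ≈ F′ i) → ∀ n → (F ⊛ G) n ≈ (F′ ⊛ G) n
  ⊛-congʳ G F≈F′ = ⊛-cong {G = G} F≈F′ (λ _ → refl)

  -- (F ⊛ G) (suc n) reduces to F 0 * G (suc n) + (F /𝕥 ⊛ G) n; this is the
  -- mirror image of that reduction.
  ⊛-suc : ∀ F G n → (F ⊛ G) (suc n) ≈ F (suc n) * G 0 + (F ⊛ G /𝕥) n
  ⊛-suc F G zero = solve 2
    (λ a b → a :+ (b :+ con 0) := b :+ (a :+ con 0)) refl (F 0 * G 1) (F 1 * G 0)
  ⊛-suc F G (suc n) = begin
    F 0 * G (suc (suc n)) + (F /𝕥 ⊛ G) (suc n)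
      ≈⟨ +-congˡ (⊛-suc (F /𝕥) G n) ⟩
    F 0 * G (suc (suc n)) + (F (suc (suc n)) * G 0 + (F /𝕥 ⊛ G /𝕥) n)
      ≈⟨ solve 3 (λ a b c → a :+ (b :+ c) := b :+ (a :+ c)) refl _ _ _ ⟩
    F (suc (suc n)) * G 0 + (F ⊛ G /𝕥) (suc n) ∎

  -- Induction on `n` for all series at once: the definition peels `F 0` off one product from the
  -- front, and `⊛-suc` peels it off the other from the back.
  ⊛-comm : ∀ F G n → (F ⊛ G) n ≈ (G ⊛ F) n
  ⊛-comm F G zero    = +-congʳ (*-comm _ _)
  ⊛-comm F G (suc n) = begin
    F 0 * G (suc n) + (F /𝕥 ⊛ G) n  ≈⟨ +-cong (*-comm _ _) (⊛-comm (F /𝕥) G n) ⟩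
    G (suc n) * F 0 + (G ⊛ F /𝕥) n  ≈⟨ ⊛-suc G F n ⟨
    (G ⊛ F) (suc n)                 ∎

  ⊛-scaleʳ : ∀ x F G n → (F ⊛ (λ i → x * G i)) n ≈ x * (F ⊛ G) n
  ⊛-scaleʳ x F G n = begin
    sum₀ n (λ i → F i * (x * G (n ∸ i)))  ≈⟨ sum₀-cong n (λ i → x∙yz≈y∙xz (F i) x (G (n ∸ i))) ⟩
    sum₀ n (λ i → x * (F i * G (n ∸ i)))  ≈⟨ sum₀-distribˡ n x (λ i → F i * G (n ∸ i)) ⟨
    x * (F ⊛ G) n                         ∎

  ⊛-scaleˡ : ∀ x F G n → ((λ i → x * F i) ⊛ G) n ≈ x * (F ⊛ G) n
  ⊛-scaleˡ x F G n = begin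
    ((λ i → x * F i) ⊛ G) n  ≈⟨ ⊛-comm (λ i → x * F i) G n ⟩
    (G ⊛ (λ i → x * F i)) n  ≈⟨ ⊛-scaleʳ x G F n ⟩
    x * (G ⊛ F) n            ≈⟨ *-congˡ (⊛-comm G F n) ⟩
    x * (F ⊛ G) n            ∎

  ⊛-distribˡ-+ : ∀ F G H n → (F ⊛ (λ i → G i + H i)) n ≈ (F ⊛ G) n + (F ⊛ H) n
  ⊛-distribˡ-+ F G H n = begin
    sum₀ n (λ i → F i * (G (n ∸ i) + H (n ∸ i)))
      ≈⟨ sum₀-cong n (λ i → distribˡ (F i) (G (n ∸ i)) (H (n ∸ i))) ⟩
    sum₀ n (λ i → F i * G (n ∸ i) + F i * H (n ∸ i))
      ≈⟨ sum₀-+ n (λ i → F i * G (n ∸ i)) (λ i → F i * H (n ∸ i)) ⟩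
    (F ⊛ G) n + (F ⊛ H) n ∎

  ⊛-distribʳ-+ : ∀ H F G n → ((λ i → F i + G i) ⊛ H) n ≈ (F ⊛ H) n + (G ⊛ H) n
  ⊛-distribʳ-+ H F G n = begin
    ((λ i → F i + G i) ⊛ H) n  ≈⟨ ⊛-comm (λ i → F i + G i) H n ⟩
    (H ⊛ (λ i → F i + G i)) n  ≈⟨ ⊛-distribˡ-+ H F G n ⟩
    (H ⊛ F) n + (H ⊛ G) n      ≈⟨ +-cong (⊛-comm H F n) (⊛-comm H G n) ⟩
    (F ⊛ H) n + (G ⊛ H) n      ∎

  ⊛-distribˡ-⊖ : ∀ F G H n → (F ⊛ (G ⊖ H)) n ≈ (F ⊛ G) n - (F ⊛ H) n
  ⊛-distribˡ-⊖ F G H n = begin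
    (F ⊛ (G ⊖ H)) n
      ≈⟨ ⊛-distribˡ-+ F G (λ i → - H i) n ⟩
    (F ⊛ G) n + (F ⊛ (λ i → - H i)) n
      ≈⟨ +-congˡ (⊛-congˡ F (λ i → sym (-1*x≈-x (H i))) n) ⟩
    (F ⊛ G) n + (F ⊛ (λ i → - 1# * H i)) n
      ≈⟨ +-congˡ (⊛-scaleʳ (- 1#) F H n) ⟩
    (F ⊛ G) n + - 1# * (F ⊛ H) n
      ≈⟨ +-congˡ (-1*x≈-x _) ⟩
    (F ⊛ G) n - (F ⊛ H) n ∎

  -- Induction on the degree with `F` varying. Dividing `F ⊛ G` by t leaves `F 0` times `G /𝕥`, plus
  -- `F /𝕥 ⊛ G`; the second summand falls to the induction hypothesis.
  ⊛-assoc : ∀ F G H n → ((F ⊛ G) ⊛ H) n ≈ (F ⊛ (G ⊛ H)) n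
  ⊛-assoc F G H zero = solve 3
    (λ a b c → (a :* b :+ con 0) :* c :+ con 0 := a :* (b :* c :+ con 0) :+ con 0)
    refl (F 0) (G 0) (H 0)
  ⊛-assoc F G H (suc n) = begin
    (F 0 * G 0 + 0#) * H (suc n) + ((λ i → F 0 * G (suc i) + (F /𝕥 ⊛ G) i) ⊛ H) n
      ≈⟨ +-congˡ (⊛-distribʳ-+ H (λ i → F 0 * G (suc i)) (F /𝕥 ⊛ G) n) ⟩
    (F 0 * G 0 + 0#) * H (suc n) + (((λ i → F 0 * G (suc i)) ⊛ H) n + ((F /𝕥 ⊛ G) ⊛ H) n)
      ≈⟨ +-congˡ (+-cong (⊛-scaleˡ (F 0) (G /𝕥) H n) (⊛-assoc (F /𝕥) G H n)) ⟩
    (F 0 * G 0 + 0#) * H (suc n) + (F 0 * (G /𝕥 ⊛ H) n + (F /𝕥 ⊛ (G ⊛ H)) n)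
      ≈⟨ solve 5 (λ a b c d e → (a :* b :+ con 0) :* c :+ (a :* d :+ e)
                                  := a :* (b :* c :+ d) :+ e)
           refl (F 0) (G 0) (H (suc n)) _ _ ⟩
    F 0 * (G ⊛ H) (suc n) + (F /𝕥 ⊛ (G ⊛ H)) n ∎

  x⊛yz≈y⊛xz : ∀ F G H n → (F ⊛ (G ⊛ H)) n ≈ (G ⊛ (F ⊛ H)) n
  x⊛yz≈y⊛xz F G H n = begin
    (F ⊛ (G ⊛ H)) n  ≈⟨ ⊛-assoc F G H n ⟨
    ((F ⊛ G) ⊛ H) n  ≈⟨ ⊛-congʳ H (⊛-comm F G) n ⟩
    ((G ⊛ F) ⊛ H) n  ≈⟨ ⊛-assoc G F H n ⟩
    (G ⊛ (F ⊛ H)) n  ∎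

  0⊛F≈0 : ∀ F n → ((λ _ → 0#) ⊛ F) n ≈ 0#
  0⊛F≈0 F n = begin
    ((λ _ → 0#) ⊛ F) n       ≈⟨ ⊛-congʳ F (λ _ → sym (zeroˡ 0#)) n ⟩
    ((λ _ → 0# * 0#) ⊛ F) n  ≈⟨ ⊛-scaleˡ 0# (λ _ → 0#) F n ⟩
    0# * _                   ≈⟨ zeroˡ _ ⟩
    0#                       ∎

  ⊛-identityˡ : ∀ F n → (𝟙 ⊛ F) n ≈ F n
  ⊛-identityˡ F zero    = solve 1 (λ a → con 1 :* a :+ con 0 := a) refl (F 0)
  ⊛-identityˡ F (suc n) = begin
    1# * F (suc n) + ((λ _ → 0#) ⊛ F) n  ≈⟨ +-cong (*-identityˡ _) (0⊛F≈0 F n) ⟩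
    F (suc n) + 0#                       ≈⟨ +-identityʳ _ ⟩
    F (suc n)                            ∎

  ⊛-identityʳ : ∀ F n → (F ⊛ 𝟙) n ≈ F n
  ⊛-identityʳ F n = trans (⊛-comm F 𝟙 n) (⊛-identityˡ F n)

  𝕥⊛-zero : ∀ F → (𝕥 ⊛ F) 0 ≈ 0#
  𝕥⊛-zero F = solve 1 (λ a → con 0 :* a :+ con 0 := con 0) refl (F 0)

  𝕥⊛-suc : ∀ F n → (𝕥 ⊛ F) (suc n) ≈ F n
  𝕥⊛-suc F n = begin
    0# * F (suc n) + (𝟙 ⊛ F) n  ≈⟨ +-cong (zeroˡ _) (⊛-identityˡ F n) ⟩
    0# + F n                    ≈⟨ +-identityˡ _ ⟩
    F n                         ∎

  𝕥⊛/𝕥 : ∀ F → F 0 ≈ 0# → ∀ n → (𝕥 ⊛ F /𝕥) n ≈ F n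
  𝕥⊛/𝕥 F F₀≈0 zero    = trans (𝕥⊛-zero (F /𝕥)) (sym F₀≈0)
  𝕥⊛/𝕥 F F₀≈0 (suc n) = 𝕥⊛-suc (F /𝕥) n

  -- The derivation t · d/dt.
  θ : Series → Series
  θ F n = (n × 1#) * F n

  -- Leibniz rule: in the i-th term the factor n splits as i + (n - i). With truncated subtraction
  -- this needs `i ≤ n`, hence the bounded congruence `sum₀-cong-≤`.
  θ-⊛ : ∀ F G n → θ (F ⊛ G) n ≈ (θ F ⊛ G) n + (F ⊛ θ G) n
  θ-⊛ F G n = begin
    (n × 1#) * sum₀ n (λ i → F i * G (n ∸ i))
      ≈⟨ sum₀-distribˡ n (n × 1#) (λ i → F i * G (n ∸ i)) ⟩
    sum₀ n (λ i → (n × 1#) * (F i * G (n ∸ i)))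
      ≈⟨ sum₀-cong-≤ n split ⟩
    sum₀ n (λ i → θ F i * G (n ∸ i) + F i * θ G (n ∸ i))
      ≈⟨ sum₀-+ n (λ i → θ F i * G (n ∸ i)) (λ i → F i * θ G (n ∸ i)) ⟩
    (θ F ⊛ G) n + (F ⊛ θ G) n ∎
    where
    split : ∀ i → i ≤ n → (n × 1#) * (F i * G (n ∸ i)) ≈ θ F i * G (n ∸ i) + F i * θ G (n ∸ i)
    split i i≤n = begin
      (n × 1#) * (F i * G (n ∸ i))
        ≡⟨ ≡.cong (λ k → (k × 1#) * (F i * G (n ∸ i))) (ℕₚ.m+[n∸m]≡n i≤n) ⟨
      ((i +ℕ (n ∸ i)) × 1#) * (F i * G (n ∸ i))
        ≈⟨ *-congʳ (×-homo-+ 1# i (n ∸ i)) ⟩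
      (i × 1# + (n ∸ i) × 1#) * (F i * G (n ∸ i))
        ≈⟨ solve 4 (λ a b x y → (a :+ b) :* (x :* y) := (a :* x) :* y :+ x :* (b :* y))
             refl (i × 1#) ((n ∸ i) × 1#) (F i) (G (n ∸ i)) ⟩
      θ F i * G (n ∸ i) + F i * θ G (n ∸ i) ∎

  -- The power rule, by induction: Leibniz yields one copy of `P ⊛ θ F`, and the induction
  -- hypothesis another `suc m` copies.
  θ-⊛^ : ∀ F m n → θ (F ⊛^ suc m) n ≈ (suc m × 1#) * (F ⊛^ m ⊛ θ F) n
  θ-⊛^ F zero n = begin
    (n × 1#) * (F ⊛ 𝟙) n         ≈⟨ *-congˡ (⊛-identityʳ F n) ⟩
    θ F n                        ≈⟨ ⊛-identityˡ (θ F) n ⟨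
    (𝟙 ⊛ θ F) n                  ≈⟨ solve 1 (λ a → a := (con 1 :+ con 0) :* a) refl _ ⟩
    (1 × 1#) * (𝟙 ⊛ θ F) n       ∎
  θ-⊛^ F (suc m) n = begin
    θ (F ⊛ P) n
      ≈⟨ θ-⊛ F P n ⟩
    (θ F ⊛ P) n + (F ⊛ θ P) n
      ≈⟨ +-cong (⊛-comm (θ F) P n) (⊛-congˡ F (θ-⊛^ F m) n) ⟩
    (P ⊛ θ F) n + (F ⊛ (λ i → (suc m × 1#) * (F ⊛^ m ⊛ θ F) i)) n
      ≈⟨ +-congˡ (⊛-scaleʳ (suc m × 1#) F (F ⊛^ m ⊛ θ F) n) ⟩
    (P ⊛ θ F) n + (suc m × 1#) * (F ⊛ (F ⊛^ m ⊛ θ F)) n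
      ≈⟨ +-congˡ (*-congˡ (⊛-assoc F (F ⊛^ m) (θ F) n)) ⟨
    (P ⊛ θ F) n + (suc m × 1#) * (P ⊛ θ F) n
      ≈⟨ solve 2 (λ k a → a :+ k :* a := (con 1 :+ k) :* a) refl (suc m × 1#) _ ⟩
    (suc (suc m) × 1#) * (P ⊛ θ F) n ∎
    where P = F ⊛^ suc m

  -- The hypothesis is the differential equation u′ = 1 - u.
  ⊛^-recurrence : ∀ u → (∀ n → θ u n ≈ (𝕥 ⊛ (𝟙 ⊖ u)) n) → ∀ m p →
    (suc p × 1#) * (u ⊛^ suc m) (suc p) ≈ (suc m × 1#) * ((u ⊛^ m) p - (u ⊛^ suc m) p)
  ⊛^-recurrence u θu m p = begin
    θ (u ⊛^ suc m) (suc p)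
      ≈⟨ θ-⊛^ u m (suc p) ⟩
    (suc m × 1#) * (U ⊛ θ u) (suc p)
      ≈⟨ *-congˡ (⊛-congˡ U θu (suc p)) ⟩
    (suc m × 1#) * (U ⊛ (𝕥 ⊛ (𝟙 ⊖ u))) (suc p)
      -- With `𝕥` in front, the coefficient at `suc p` becomes one at `p`: this is the drop in
      -- degree of the recurrence.
      ≈⟨ *-congˡ (x⊛yz≈y⊛xz U 𝕥 (𝟙 ⊖ u) (suc p)) ⟩
    (suc m × 1#) * (𝕥 ⊛ (U ⊛ (𝟙 ⊖ u))) (suc p)
      ≈⟨ *-congˡ (𝕥⊛-suc (U ⊛ (𝟙 ⊖ u)) p) ⟩
    (suc m × 1#) * (U ⊛ (𝟙 ⊖ u)) p
      ≈⟨ *-congˡ (⊛-distribˡ-⊖ U 𝟙 u p) ⟩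
    (suc m × 1#) * ((U ⊛ 𝟙) p - (U ⊛ u) p)
      ≈⟨ *-congˡ (+-cong (⊛-identityʳ U p) (-‿cong (⊛-comm U u p))) ⟩
    (suc m × 1#) * (U p - (u ⊛^ suc m) p) ∎
    where U = u ⊛^ m

-- Falling factorials and differences of Newton expansions.

module FallingFactorialProperties {c ℓ} (R : CommutativeRing c ℓ) where
  open CommutativeRing R
  open RingNotation R
  open PowerSeriesProperties R using (sum₀-cong; sum₀-+)
  open Algebra.Properties.Ring ring using (-0#≈0#; -‿+-comm; +-cancelˡ)
  open Algebra.Properties.Semiring.Mult semiring using (×1-homo-*)
  open NaturalCoefficients commutativeSemiring using (solve; con; _:+_; _:*_; _:=_)
  open Relation.Binary.Reasoning.Setoid setoid

  infix 9 _⁽_⁾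
  _⁽_⁾ : Carrier → ℕ → Carrier
  _⁽_⁾ = fallingFactorial

  -- The factors are x + 1, x, x - 1, ..., and all but the first are those of `x ⁽ l ⁾`. Induction
  -- is used because the definition appends factors at the far end.
  [x+1]⁽ˡ⁺¹⁾ : ∀ x l → (x + 1#) ⁽ suc l ⁾ ≈ (x + 1#) * x ⁽ l ⁾
  [x+1]⁽ˡ⁺¹⁾ x zero = begin
    1# * (x + 1# - 0#)  ≈⟨ *-congˡ (trans (+-congˡ -0#≈0#) (+-identityʳ _)) ⟩
    1# * (x + 1#)       ≈⟨ *-comm _ _ ⟩
    (x + 1#) * 1#       ∎
  [x+1]⁽ˡ⁺¹⁾ x (suc l) = begin
    (x + 1#) ⁽ suc l ⁾ * (x + 1# - (1# + l × 1#))
      ≈⟨ *-cong ([x+1]⁽ˡ⁺¹⁾ x l) cancel-1 ⟩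
    (x + 1#) * x ⁽ l ⁾ * (x - l × 1#)
      ≈⟨ *-assoc _ _ _ ⟩
    (x + 1#) * x ⁽ suc l ⁾ ∎
    where
    cancel-1 : x + 1# - (1# + l × 1#) ≈ x - l × 1#
    cancel-1 = begin
      x + 1# - (1# + l × 1#)
        ≈⟨ +-congˡ (-‿+-comm 1# (l × 1#)) ⟨
      x + 1# + (- 1# + - (l × 1#))
        ≈⟨ solve 3 (λ x a b → x :+ con 1 :+ (a :+ b) := (con 1 :+ a) :+ (x :+ b)) refl x (- 1#) (- (l × 1#)) ⟩
      (1# - 1#) + (x - l × 1#)
        ≈⟨ trans (+-congʳ (-‿inverseʳ 1#)) (+-identityˡ _) ⟩
      x - l × 1# ∎

  -- Once x + 1 is pulled out in front, write it as (x - l) + (l + 1): the first part completes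
  -- `x ⁽ suc l ⁾`, the second is the difference.
  Δ⁽ˡ⁺¹⁾ : ∀ x l → (x + 1#) ⁽ suc l ⁾ ≈ x ⁽ suc l ⁾ + (suc l × 1#) * x ⁽ l ⁾
  Δ⁽ˡ⁺¹⁾ x l = begin
    (x + 1#) ⁽ suc l ⁾
      ≈⟨ [x+1]⁽ˡ⁺¹⁾ x l ⟩
    (x + 1#) * x ⁽ l ⁾
      ≈⟨ *-congʳ (+-congʳ (+-identityʳ x)) ⟨
    (x + 0# + 1#) * x ⁽ l ⁾
      ≈⟨ *-congʳ (+-congʳ (+-congˡ (-‿inverseˡ (l × 1#)))) ⟨
    (x + (- (l × 1#) + l × 1#) + 1#) * x ⁽ l ⁾
      ≈⟨ solve 4 (λ x a b p → (x :+ (a :+ b) :+ con 1) :* p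
                                := p :* (x :+ a) :+ (con 1 :+ b) :* p)
           refl x (- (l × 1#)) (l × 1#) (x ⁽ l ⁾) ⟩
    x ⁽ suc l ⁾ + (suc l × 1#) * x ⁽ l ⁾ ∎

  0⁽ˡ⁺¹⁾≈0 : ∀ l → 0# ⁽ suc l ⁾ ≈ 0#
  0⁽ˡ⁺¹⁾≈0 zero    = trans (*-identityˡ _) (-‿inverseʳ 0#)
  0⁽ˡ⁺¹⁾≈0 (suc l) = trans (*-congʳ (0⁽ˡ⁺¹⁾≈0 l)) (zeroˡ _)

  newton : ℕ → (ℕ → Carrier) → Carrier → Carrier
  newton n f x = sum₀ n (λ l → f l * x ⁽ l ⁾)

  newton-0 : ∀ n f → newton n f 0# ≈ f 0
  newton-0 zero    f = solve 1 (λ a → a :* con 1 :+ con 0 := a) refl (f 0)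
  newton-0 (suc n) f = begin
    f 0 * 1# + sum₀ n (λ l → f (suc l) * 0# ⁽ suc l ⁾)
      ≈⟨ +-cong (*-identityʳ (f 0))
           (sum₀-cong n (λ l → trans (*-congˡ (0⁽ˡ⁺¹⁾≈0 l)) (zeroʳ (f (suc l))))) ⟩
    f 0 + sum₀ n (λ _ → 0#)
      ≈⟨ +-congˡ (sum-replicate-zero (suc n)) ⟩
    f 0 + 0#
      ≈⟨ +-identityʳ _ ⟩
    f 0 ∎

  -- The forward difference, acting on Newton coefficients instead of on functions.
  Δ : (ℕ → Carrier) → ℕ → Carrier
  Δ f l = f (suc l) * (suc l × 1#)

  -- The term of index 0 is constant, so the difference has an expansion of length one less;
  -- `newton-injective` recurses on this drop.
  newton-Δ : ∀ n f x → newton (suc n) f (x + 1#) ≈ newton (suc n) f x + newton n (Δ f) x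
  newton-Δ n f x = begin
    f 0 * 1# + sum₀ n (λ l → f (suc l) * (x + 1#) ⁽ suc l ⁾)
      ≈⟨ +-congˡ (sum₀-cong n expand) ⟩
    f 0 * 1# + sum₀ n (λ l → f (suc l) * x ⁽ suc l ⁾ + Δ f l * x ⁽ l ⁾)
      ≈⟨ +-congˡ (sum₀-+ n (λ l → f (suc l) * x ⁽ suc l ⁾) (λ l → Δ f l * x ⁽ l ⁾)) ⟩
    f 0 * 1# + (sum₀ n (λ l → f (suc l) * x ⁽ suc l ⁾) + newton n (Δ f) x)
      ≈⟨ +-assoc _ _ _ ⟨
    newton (suc n) f x + newton n (Δ f) x ∎
    where
    expand : ∀ l → f (suc l) * (x + 1#) ⁽ suc l ⁾ ≈ f (suc l) * x ⁽ suc l ⁾ + Δ f l * x ⁽ l ⁾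
    expand l = begin
      f (suc l) * (x + 1#) ⁽ suc l ⁾
        ≈⟨ *-congˡ (Δ⁽ˡ⁺¹⁾ x l) ⟩
      f (suc l) * (x ⁽ suc l ⁾ + (suc l × 1#) * x ⁽ l ⁾)
        ≈⟨ distribˡ _ _ _ ⟩
      f (suc l) * x ⁽ suc l ⁾ + f (suc l) * ((suc l × 1#) * x ⁽ l ⁾)
        ≈⟨ +-congˡ (*-assoc _ _ _) ⟨
      f (suc l) * x ⁽ suc l ⁾ + Δ f l * x ⁽ l ⁾ ∎

  -- l! f l is the value at 0 of the l-th difference of newton n f.
  newton-injective : ∀ n f g → (∀ x → newton n f x ≈ newton n g x) →
    ∀ l → l ≤ n → ((l !) × 1#) * f l ≈ ((l !) × 1#) * g l
  newton-injective n f g f≈g zero z≤n =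
    *-congˡ (trans (sym (newton-0 n f)) (trans (f≈g 0#) (newton-0 n g)))
  newton-injective (suc n) f g f≈g (suc l) (s≤s l≤n) = begin
    ((suc l !) × 1#) * f (suc l)  ≈⟨ unfold f ⟩
    ((l !) × 1#) * Δ f l          ≈⟨ newton-injective n (Δ f) (Δ g) Δf≈Δg l l≤n ⟩
    ((l !) × 1#) * Δ g l          ≈⟨ unfold g ⟨
    ((suc l !) × 1#) * g (suc l)  ∎
    where
    unfold : ∀ h → ((suc l !) × 1#) * h (suc l) ≈ ((l !) × 1#) * Δ h l
    unfold h = begin
      ((suc l *ℕ l !) × 1#) * h (suc l)
        ≈⟨ *-congʳ (×1-homo-* (suc l) (l !)) ⟩
      (suc l × 1#) * ((l !) × 1#) * h (suc l)
        ≈⟨ solve 3 (λ a b c → a :* b :* c := b :* (c :* a)) refl (suc l × 1#) ((l !) × 1#) (h (suc l)) ⟩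
      ((l !) × 1#) * Δ h l ∎

    Δf≈Δg : ∀ x → newton n (Δ f) x ≈ newton n (Δ g) x
    -- Compare the hypothesis at x + 1 with the hypothesis at x and cancel the common value.
    Δf≈Δg x = +-cancelˡ (newton (suc n) f x) _ _ (begin
      newton (suc n) f x + newton n (Δ f) x  ≈⟨ newton-Δ n f x ⟨
      newton (suc n) f (x + 1#)              ≈⟨ f≈g (x + 1#) ⟩
      newton (suc n) g (x + 1#)              ≈⟨ newton-Δ n g x ⟩
      newton (suc n) g x + newton n (Δ g) x  ≈⟨ +-congʳ (f≈g x) ⟨
      newton (suc n) f x + newton n (Δ g) x  ∎)

-- Natural numbers and factorials inside ℚ.

fromℚᵘ-homo-+ : ∀ p q → fromℚᵘ (p ℚᵘ.+ q) ≡ fromℚᵘ p +ℚ fromℚᵘ q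
-- `fromℚᵘ` reduces to lowest terms; after `toℚᵘ` both sides are compared only up to equality of
-- fractions, which does not see the reduction.
fromℚᵘ-homo-+ p q = ℚₚ.toℚᵘ-injective (ℚᵘₚ.≃-trans (ℚₚ.toℚᵘ-fromℚᵘ (p ℚᵘ.+ q))
  (ℚᵘₚ.≃-sym (ℚᵘₚ.≃-trans (ℚₚ.toℚᵘ-homo-+ (fromℚᵘ p) (fromℚᵘ q))
    (ℚᵘₚ.+-cong (ℚₚ.toℚᵘ-fromℚᵘ p) (ℚₚ.toℚᵘ-fromℚᵘ q)))))

fromℚᵘ-homo-* : ∀ p q → fromℚᵘ (p ℚᵘ.* q) ≡ fromℚᵘ p *ℚ fromℚᵘ q
fromℚᵘ-homo-* p q = ℚₚ.toℚᵘ-injective (ℚᵘₚ.≃-trans (ℚₚ.toℚᵘ-fromℚᵘ (p ℚᵘ.* q))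
  (ℚᵘₚ.≃-sym (ℚᵘₚ.≃-trans (ℚₚ.toℚᵘ-homo-* (fromℚᵘ p) (fromℚᵘ q))
    (ℚᵘₚ.*-cong (ℚₚ.toℚᵘ-fromℚᵘ p) (ℚₚ.toℚᵘ-fromℚᵘ q)))))

-- `ℕ→ℚ m` is `fromℚᵘ` of the fraction m/1, so the sum can be computed on unnormalised fractions.
ℕ→ℚ-homo-+ : ∀ m n → ℕ→ℚ (m +ℕ n) ≡ ℕ→ℚ m +ℚ ℕ→ℚ n
ℕ→ℚ-homo-+ m n = ≡.trans
  (ℚₚ.fromℚᵘ-cong {mkℚᵘ (ℤ.+ (m +ℕ n)) 0} {p ℚᵘ.+ q} (*≡* (cong (ℤ._* ℤ.1ℤ) (≡.sym
    (cong₂ ℤ._+_ (ℤₚ.*-identityʳ (ℤ.+ m)) (ℤₚ.*-identityʳ (ℤ.+ n)))))))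
  (fromℚᵘ-homo-+ p q)
  where
  p = mkℚᵘ (ℤ.+ m) 0
  q = mkℚᵘ (ℤ.+ n) 0

ℕ→ℚ-homo-* : ∀ m n → ℕ→ℚ (m *ℕ n) ≡ ℕ→ℚ m *ℚ ℕ→ℚ n
ℕ→ℚ-homo-* m n = ≡.trans
  (ℚₚ.fromℚᵘ-cong {mkℚᵘ (ℤ.+ (m *ℕ n)) 0} {p ℚᵘ.* q}
    (*≡* (cong (ℤ._* ℤ.1ℤ) (ℤₚ.pos-* m n))))
  (fromℚᵘ-homo-* p q)
  where
  p = mkℚᵘ (ℤ.+ m) 0
  q = mkℚᵘ (ℤ.+ n) 0

ℕ→ℚ-*-inverseʳ : ∀ n .{{_ : NonZero n}} → ℕ→ℚ n *ℚ (ℤ.+ 1 ℚ./ n) ≡ 1ℚ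
ℕ→ℚ-*-inverseʳ n@(suc n-1) = ≡.trans
  (≡.sym (fromℚᵘ-homo-* p q))
  (ℚₚ.fromℚᵘ-cong {p ℚᵘ.* q} {ℚᵘ.1ℚᵘ} (ℚᵘₚ.*-inverseʳ p))
  where
  p = mkℚᵘ (ℤ.+ n) 0
  q = mkℚᵘ (ℤ.+ 1) n-1

-- The closed form of `n C k` is a quotient in ℕ; divisibility of n! by k!(n-k)! makes the division
-- exact.
nCk*k!*[n∸k]!≡n! : ∀ {n k} → k ≤ n → (n C k) *ℕ (k ! *ℕ (n ∸ k) !) ≡ n !
nCk*k!*[n∸k]!≡n! {n} {k} k≤n = ≡.trans
  (cong (_*ℕ (k ! *ℕ (n ∸ k) !)) (nCk≡n!/k![n-k]! k≤n))
  (m/n*n≡m {{k ℕₚ.!* (n ∸ k) !≢0}} (k![n∸k]!∣n! k≤n))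

-- Stirling numbers and the rational coefficients of the powers of 1 - e⁻ᵗ.

module _ where
  open RingNotation ℚ-ring
  open FallingFactorialProperties ℚ-ring using (newton-injective)
  open +-*-Solver using (solve; con; _:+_; _:-_; _:*_; _:=_)
  open ≡.≡-Reasoning

  -- Links two encodings of a natural number: the fraction n/1 of the generating functions and the
  -- multiple of 1 in falling factorials and `stirling₂`.
  ℕ→ℚ≡×1 : ∀ n → ℕ→ℚ n ≡ n × 1ℚ
  ℕ→ℚ≡×1 zero    = ≡.refl
  ℕ→ℚ≡×1 (suc n) = ≡.trans (ℕ→ℚ-homo-+ 1 n) (cong (1ℚ +ℚ_) (ℕ→ℚ≡×1 n))

  ℕ→ℚ-suc! : ∀ n → ℕ→ℚ (suc n !) ≡ ℕ→ℚ (suc n) *ℚ ℕ→ℚ (n !)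
  ℕ→ℚ-suc! n = ℕ→ℚ-homo-* (suc n) (n !)

  n!*1/n!≡1 : ∀ n → ℕ→ℚ (n !) *ℚ 1/ n ! ≡ 1ℚ
  n!*1/n!≡1 n = ℕ→ℚ-*-inverseʳ (n !) {{n ℕₚ.!≢0}}

  [1+n]*1/[1+n]!≡1/n! : ∀ n → ℕ→ℚ (suc n) *ℚ 1/ suc n ! ≡ 1/ n !
  [1+n]*1/[1+n]!≡1/n! n = begin
    a *ℚ 1/ suc n !
      ≡⟨ ≡.sym (ℚₚ.*-identityˡ _) ⟩
    1ℚ *ℚ (a *ℚ 1/ suc n !)
      -- Replacing 1 by n! · 1/n! lets (n + 1) · n! meet its reciprocal and leaves 1/n!.
      ≡⟨ cong (_*ℚ (a *ℚ 1/ suc n !)) (≡.sym (n!*1/n!≡1 n)) ⟩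
    ℕ→ℚ (n !) *ℚ 1/ n ! *ℚ (a *ℚ 1/ suc n !)
      ≡⟨ solve 4 (λ a b c d → c :* b :* (a :* d) := a :* c :* d :* b) ≡.refl a (1/ n !) (ℕ→ℚ (n !)) (1/ suc n !) ⟩
    a *ℚ ℕ→ℚ (n !) *ℚ 1/ suc n ! *ℚ 1/ n !
      ≡⟨ cong (λ b → b *ℚ 1/ suc n ! *ℚ 1/ n !) (≡.sym (ℕ→ℚ-suc! n)) ⟩
    ℕ→ℚ (suc n !) *ℚ 1/ suc n ! *ℚ 1/ n !
      ≡⟨ cong (_*ℚ 1/ n !) (n!*1/n!≡1 (suc n)) ⟩
    1ℚ *ℚ 1/ n !
      ≡⟨ ℚₚ.*-identityˡ _ ⟩
    1/ n ! ∎
    where a = ℕ→ℚ (suc n)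

  -- The source of the binomial coefficient in the product rule for exponential generating
  -- functions.
  n!≡nCp*p!*[n-p]! : ∀ {n p} → p ≤ n →
    ℕ→ℚ (n !) ≡ ℕ→ℚ (n C p) *ℚ (ℕ→ℚ (p !) *ℚ ℕ→ℚ ((n ∸ p) !))
  n!≡nCp*p!*[n-p]! {n} {p} p≤n = begin
    ℕ→ℚ (n !)
      ≡⟨ cong ℕ→ℚ (nCk*k!*[n∸k]!≡n! p≤n) ⟨
    ℕ→ℚ ((n C p) *ℕ (p ! *ℕ (n ∸ p) !))
      ≡⟨ ℕ→ℚ-homo-* (n C p) _ ⟩
    ℕ→ℚ (n C p) *ℚ ℕ→ℚ (p ! *ℕ (n ∸ p) !)
      ≡⟨ cong (ℕ→ℚ (n C p) *ℚ_) (ℕ→ℚ-homo-* (p !) _) ⟩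
    ℕ→ℚ (n C p) *ℚ (ℕ→ℚ (p !) *ℚ ℕ→ℚ ((n ∸ p) !)) ∎

  -- Both sequences are Newton coefficients of xⁿ. The bound is essential, since `IsStirling₂` does
  -- not constrain `S₂ n l` for l > n.
  l!*stirling₂ : ∀ S₂ → IsStirling₂ S₂ → ∀ {n l} → l ≤ n →
    ℕ→ℚ (l !) *ℚ stirling₂ n l ≡ ℕ→ℚ (l !) *ℚ S₂ n l
  l!*stirling₂ S₂ isS₂ {n} {l} l≤n = begin
    ℕ→ℚ (l !) *ℚ stirling₂ n l    ≡⟨ cong (_*ℚ stirling₂ n l) (ℕ→ℚ≡×1 (l !)) ⟩
    ((l !) × 1ℚ) *ℚ stirling₂ n l
      ≡⟨ newton-injective n (stirling₂ n) (S₂ n)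
           (λ x → ≡.trans (≡.sym (stirling₂-isStirling₂ n x)) (isS₂ n x)) l l≤n ⟩
    ((l !) × 1ℚ) *ℚ S₂ n l        ≡⟨ cong (_*ℚ S₂ n l) (ℕ→ℚ≡×1 (l !)) ⟨
    ℕ→ℚ (l !) *ℚ S₂ n l           ∎

  -- The coefficient of tᵖ/p! in (1 - e⁻ᵗ)ᵐ.
  coeff : ℕ → ℕ → ℚ
  coeff m p = sign (m +ℕ p) *ℚ (ℕ→ℚ (m !) *ℚ stirling₂ p m)

  -- The Stirling recurrence multiplied by (m + 1)!. Raising both indices keeps the sign and raising
  -- one flips it, which produces the subtraction found in `⊛^-recurrence`.
  coeff-suc : ∀ m p → coeff (suc m) (suc p) ≡ ℕ→ℚ (suc m) *ℚ (coeff m p -ℚ coeff (suc m) p)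
  coeff-suc m p = begin
    sign (suc (m +ℕ suc p)) *ℚ (ℕ→ℚ (suc m !) *ℚ (S +ℚ (suc m × 1ℚ) *ℚ S′))
      -- Rewriting m + (p + 1) as a successor lets `sign` unfold to two factors -1.
      ≡⟨ cong₂ (λ a b → sign (suc a) *ℚ (ℕ→ℚ (suc m !) *ℚ (S +ℚ b *ℚ S′)))
           (ℕₚ.+-suc m p) (≡.sym (ℕ→ℚ≡×1 (suc m))) ⟩
    (-ℚ 1ℚ) *ℚ ((-ℚ 1ℚ) *ℚ s) *ℚ (ℕ→ℚ (suc m !) *ℚ (S +ℚ k *ℚ S′))
      ≡⟨ cong (λ a → (-ℚ 1ℚ) *ℚ ((-ℚ 1ℚ) *ℚ s) *ℚ (a *ℚ (S +ℚ k *ℚ S′))) (ℕ→ℚ-suc! m) ⟩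
    (-ℚ 1ℚ) *ℚ ((-ℚ 1ℚ) *ℚ s) *ℚ (k *ℚ ℕ→ℚ (m !) *ℚ (S +ℚ k *ℚ S′))
      ≡⟨ solve 5 (λ s k f S S′ →
           con (-ℚ 1ℚ) :* (con (-ℚ 1ℚ) :* s) :* (k :* f :* (S :+ k :* S′))
             := k :* (s :* (f :* S) :- con (-ℚ 1ℚ) :* s :* (k :* f :* S′)))
           ≡.refl s k (ℕ→ℚ (m !)) S S′ ⟩
    k *ℚ (coeff m p -ℚ (-ℚ 1ℚ) *ℚ s *ℚ (k *ℚ ℕ→ℚ (m !) *ℚ S′))
      ≡⟨ cong (λ a → k *ℚ (coeff m p -ℚ (-ℚ 1ℚ) *ℚ s *ℚ (a *ℚ S′))) (ℕ→ℚ-suc! m) ⟨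
    k *ℚ (coeff m p -ℚ coeff (suc m) p) ∎
    where
    k  = ℕ→ℚ (suc m)
    s  = sign (m +ℕ p)
    S  = stirling₂ p m
    S′ = stirling₂ p (suc m)

  coeff-zero : ∀ m → coeff (suc m) 0 ≡ 0ℚ
  coeff-zero m = solve 2 (λ s f → s :* (f :* con 0ℚ) := con 0ℚ) ≡.refl (sign (suc m +ℕ 0)) (ℕ→ℚ (suc m !))

  coeff-0-suc : ∀ p → coeff 0 (suc p) ≡ 0ℚ
  coeff-0-suc p = solve 1 (λ s → s :* (con 1ℚ :* con 0ℚ) := con 0ℚ) ≡.refl (sign (suc p))

-- The generating functions over a ℚ-algebra.

module PolyBernoulliProperties {c ℓ} (A : ℚ-Algebra c ℓ) where
  open PolyBernoulli A
  open IsRingHomomorphism ι-isRingHomomorphism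
  open PowerSeriesProperties commutativeRing
  open FallingFactorialProperties commutativeRing using (Δ⁽ˡ⁺¹⁾)
  open Algebra.Properties.Ring ring
    using (xyx⁻¹≈y; ⁻¹-anti-homo‿-; -‿distribʳ-*; -‿involutive)
  open NaturalCoefficients commutativeSemiring using (solve; con; _:+_; _:*_; _:=_)
  open Relation.Binary.Reasoning.Setoid setoid

  ι-cong : ∀ {p q} → p ≡ q → ι p ≈ ι q
  ι-cong p≡q = reflexive (cong ι p≡q)

  ι[ℕ→ℚ] : ∀ n → ι (ℕ→ℚ n) ≈ n × 1#
  ι[ℕ→ℚ] zero    = 0#-homo
  ι[ℕ→ℚ] (suc n) = begin
    ι (ℕ→ℚ (suc n))      ≈⟨ ι-cong (ℕ→ℚ-homo-+ 1 n) ⟩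
    ι (1ℚ +ℚ ℕ→ℚ n)      ≈⟨ +-homo 1ℚ (ℕ→ℚ n) ⟩
    ι 1ℚ + ι (ℕ→ℚ n)     ≈⟨ +-cong 1#-homo (ι[ℕ→ℚ] n) ⟩
    1# + n × 1#          ∎

  -- Coefficientwise this is `Δ⁽ˡ⁺¹⁾` divided by (n + 1)!: its factor n + 1 turns 1/(n + 1)! into
  -- 1/n!.
  Δ[1+t]^ : ∀ x n → ([1+t]^ (x + 1#) ⊖ [1+t]^ x) n ≈ (𝕥 ⊛ [1+t]^ x) n
  Δ[1+t]^ x zero    = trans (-‿inverseʳ _) (sym (𝕥⊛-zero ([1+t]^ x)))
  Δ[1+t]^ x (suc n) = begin
    d * (x + 1#) ⟦ suc n ⟧ - d * x ⟦ suc n ⟧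
      ≈⟨ +-congʳ (trans (*-congˡ (Δ⁽ˡ⁺¹⁾ x n)) (distribˡ _ _ _)) ⟩
    d * x ⟦ suc n ⟧ + d * ((suc n × 1#) * x ⟦ n ⟧) - d * x ⟦ suc n ⟧
      ≈⟨ xyx⁻¹≈y _ _ ⟩
    d * ((suc n × 1#) * x ⟦ n ⟧)
      ≈⟨ solve 3 (λ a b c → a :* (b :* c) := (b :* a) :* c) refl d (suc n × 1#) (x ⟦ n ⟧) ⟩
    (suc n × 1#) * d * x ⟦ n ⟧
      ≈⟨ *-congʳ (*-congʳ (ι[ℕ→ℚ] (suc n))) ⟨
    ι (ℕ→ℚ (suc n)) * d * x ⟦ n ⟧
      ≈⟨ *-congʳ (*-homo _ _) ⟨
    ι (ℕ→ℚ (suc n) *ℚ 1/ suc n !) * x ⟦ n ⟧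
      ≈⟨ *-congʳ (ι-cong ([1+n]*1/[1+n]!≡1/n! n)) ⟩
    ([1+t]^ x) n
      ≈⟨ 𝕥⊛-suc ([1+t]^ x) n ⟨
    (𝕥 ⊛ [1+t]^ x) (suc n) ∎
    where
    infix 9 _⟦_⟧
    _⟦_⟧ = fallingFactorial
    d = ι (1/ suc n !)

  u : Series
  u = 𝟙 ⊖ exp[-t]

  exp[-t]₀ : exp[-t] 0 ≈ 1#
  exp[-t]₀ = 1#-homo

  -- The differential equation of e⁻ᵗ, read off coefficientwise.
  exp[-t]-suc : ∀ n → (suc n × 1#) * exp[-t] (suc n) ≈ - exp[-t] n
  exp[-t]-suc n = begin
    (suc n × 1#) * exp[-t] (suc n)
      ≈⟨ *-congʳ (ι[ℕ→ℚ] (suc n)) ⟨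
    ι (ℕ→ℚ (suc n)) * exp[-t] (suc n)
      ≈⟨ *-homo _ _ ⟨
    ι (ℕ→ℚ (suc n) *ℚ ((-ℚ 1ℚ) *ℚ sign n *ℚ 1/ suc n !))
      ≈⟨ ι-cong (+-*-Solver.solve 3 (λ k s d → k ∙ (Qcon (-ℚ 1ℚ) ∙ s ∙ d) Q= ⊝ (s ∙ (k ∙ d))) ≡.refl
           (ℕ→ℚ (suc n)) (sign n) (1/ suc n !)) ⟩
    ι (-ℚ (sign n *ℚ (ℕ→ℚ (suc n) *ℚ 1/ suc n !)))
      ≈⟨ ι-cong (cong (λ a → -ℚ (sign n *ℚ a)) ([1+n]*1/[1+n]!≡1/n! n)) ⟩
    ι (-ℚ (sign n *ℚ 1/ n !))
      ≈⟨ -‿homo _ ⟩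
    - exp[-t] n ∎
    where open +-*-Solver using () renaming (_:*_ to _∙_; con to Qcon; _:=_ to _Q=_; :-_ to ⊝_)

  𝟙⊖u : ∀ n → (𝟙 ⊖ u) n ≈ exp[-t] n
  𝟙⊖u n = begin
    𝟙 n - (𝟙 n - exp[-t] n)    ≈⟨ +-congˡ (⁻¹-anti-homo‿- (𝟙 n) (exp[-t] n)) ⟩
    𝟙 n + (exp[-t] n - 𝟙 n)    ≈⟨ +-assoc _ _ _ ⟨
    𝟙 n + exp[-t] n - 𝟙 n      ≈⟨ xyx⁻¹≈y _ _ ⟩
    exp[-t] n                  ∎

  u₀≈0 : u 0 ≈ 0#
  u₀≈0 = trans (+-congˡ (-‿cong exp[-t]₀)) (-‿inverseʳ 1#)

  -- The equation u′ = 1 - u multiplied by t, in the form that `⊛^-recurrence` takes as hypothesis.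
  θu : ∀ n → θ u n ≈ (𝕥 ⊛ (𝟙 ⊖ u)) n
  θu zero    = trans (zeroˡ (u 0)) (sym (𝕥⊛-zero (𝟙 ⊖ u)))
  θu (suc n) = begin
    (suc n × 1#) * (0# - exp[-t] (suc n))  ≈⟨ *-congˡ (+-identityˡ _) ⟩
    (suc n × 1#) * - exp[-t] (suc n)       ≈⟨ -‿distribʳ-* _ _ ⟨
    - ((suc n × 1#) * exp[-t] (suc n))     ≈⟨ -‿cong (exp[-t]-suc n) ⟩
    - - exp[-t] n                          ≈⟨ -‿involutive _ ⟩
    exp[-t] n                              ≈⟨ 𝟙⊖u n ⟨
    (𝟙 ⊖ u) n                              ≈⟨ 𝕥⊛-suc (𝟙 ⊖ u) n ⟨
    (𝕥 ⊛ (𝟙 ⊖ u)) (suc n)                  ∎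

  -- Both sides have the same values at m = 0 and at p = 0, and `⊛^-recurrence` and `coeff-suc` give
  -- them the same recurrence. Each recursive call lowers p, while m drops or stays.
  egfCoefficient-u⊛^ : ∀ m p → egfCoefficient (u ⊛^ m) p ≈ ι (coeff m p)
  egfCoefficient-u⊛^ zero    zero    = *-identityʳ (ι 1ℚ)
  egfCoefficient-u⊛^ zero    (suc p) = begin
    ι (ℕ→ℚ (suc p !)) * 0#  ≈⟨ zeroʳ _ ⟩
    0#                      ≈⟨ 0#-homo ⟨
    ι 0ℚ                    ≈⟨ ι-cong (coeff-0-suc p) ⟨
    ι (coeff 0 (suc p))     ∎
  egfCoefficient-u⊛^ (suc m) zero    = begin
    ι 1ℚ * (u 0 * (u ⊛^ m) 0 + 0#)  ≈⟨ *-congˡ (+-congʳ (*-congʳ u₀≈0)) ⟩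
    ι 1ℚ * (0# * (u ⊛^ m) 0 + 0#)   ≈⟨ solve 2 (λ a b → a :* (con 0 :* b :+ con 0) := con 0) refl (ι 1ℚ) ((u ⊛^ m) 0) ⟩
    0#                              ≈⟨ 0#-homo ⟨
    ι 0ℚ                            ≈⟨ ι-cong (coeff-zero m) ⟨
    ι (coeff (suc m) 0)             ∎
  egfCoefficient-u⊛^ (suc m) (suc p) = begin
    ι (ℕ→ℚ (suc p !)) * V (suc p)
      -- Of (p + 1)!, the factor p + 1 feeds the recurrence and p! remains for the coefficients at
      -- p.
      ≈⟨ *-congʳ (trans (ι-cong (ℕ→ℚ-suc! p)) (*-homo _ _)) ⟩
    ι (ℕ→ℚ (suc p)) * f * V (suc p)
      ≈⟨ *-congʳ (*-congʳ (ι[ℕ→ℚ] (suc p))) ⟩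
    (suc p × 1#) * f * V (suc p)
      ≈⟨ solve 3 (λ k f v → k :* f :* v := f :* (k :* v)) refl (suc p × 1#) f (V (suc p)) ⟩
    f * ((suc p × 1#) * V (suc p))
      ≈⟨ *-congˡ (⊛^-recurrence u θu m p) ⟩
    f * ((suc m × 1#) * (U p - V p))
      ≈⟨ solve 4 (λ f k a b → f :* (k :* (a :+ b)) := k :* (f :* a :+ f :* b)) refl f (suc m × 1#) (U p) (- V p) ⟩
    (suc m × 1#) * (f * U p + f * - V p)
      ≈⟨ *-cong (sym (ι[ℕ→ℚ] (suc m))) (+-congˡ (sym (-‿distribʳ-* f (V p)))) ⟩
    ι (ℕ→ℚ (suc m)) * (f * U p - f * V p)
      ≈⟨ *-congˡ (+-cong (egfCoefficient-u⊛^ m p) (-‿cong (egfCoefficient-u⊛^ (suc m) p))) ⟩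
    ι (ℕ→ℚ (suc m)) * (ι (coeff m p) - ι (coeff (suc m) p))
      ≈⟨ *-congˡ (+-congˡ (-‿homo _)) ⟨
    ι (ℕ→ℚ (suc m)) * (ι (coeff m p) + ι (-ℚ coeff (suc m) p))
      ≈⟨ trans (*-congˡ (sym (+-homo _ _))) (sym (*-homo _ _)) ⟩
    ι (ℕ→ℚ (suc m) *ℚ (coeff m p -ℚ coeff (suc m) p))
      ≈⟨ ι-cong (coeff-suc m p) ⟨
    ι (coeff (suc m) (suc p)) ∎
    where
    U = u ⊛^ m
    V = u ⊛^ suc m
    f = ι (ℕ→ℚ (p !))

  egfCoefficient-⊖ : ∀ F G n → egfCoefficient F n - egfCoefficient G n ≈ egfCoefficient (F ⊖ G) n
  egfCoefficient-⊖ F G n = begin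
    f * F n - f * G n    ≈⟨ +-congˡ (-‿distribʳ-* f (G n)) ⟩
    f * F n + f * - G n  ≈⟨ distribˡ _ _ _ ⟨
    f * (F n - G n)      ∎
    where f = ι (ℕ→ℚ (n !))

  -- `𝕥 /𝕥` is definitionally `𝟙`.
  𝕥⊘ : ∀ F H n → (𝕥 ⊘ F ⊛ H) n ≈ (recip (F /𝕥) ⊛ H) n
  𝕥⊘ F H = ⊛-congʳ H (⊛-identityˡ (recip (F /𝕥)))

  -- Both quotients by `G` contain `recip (G /𝕥)`. The free factor t moves onto `F /𝕥` and restores
  -- `F`, which requires a vanishing constant term.
  ⊘-⊛𝕥⊛ : ∀ F G H → F 0 ≈ 0# → ∀ n → (F ⊘ G ⊛ (𝕥 ⊛ H)) n ≈ (F ⊛ (𝕥 ⊘ G ⊛ H)) n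
  ⊘-⊛𝕥⊛ F G H F₀≈0 n = begin
    ((F /𝕥 ⊛ r) ⊛ (𝕥 ⊛ H)) n  ≈⟨ x⊛yz≈y⊛xz (F /𝕥 ⊛ r) 𝕥 H n ⟩
    (𝕥 ⊛ ((F /𝕥 ⊛ r) ⊛ H)) n  ≈⟨ ⊛-congˡ 𝕥 (⊛-assoc (F /𝕥) r H) n ⟩
    (𝕥 ⊛ (F /𝕥 ⊛ (r ⊛ H))) n  ≈⟨ ⊛-assoc 𝕥 (F /𝕥) (r ⊛ H) n ⟨
    ((𝕥 ⊛ F /𝕥) ⊛ (r ⊛ H)) n  ≈⟨ ⊛-cong (𝕥⊛/𝕥 F F₀≈0) (λ i → sym (𝕥⊘ G H i)) n ⟩
    (F ⊛ (𝕥 ⊘ G ⊛ H)) n       ∎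
    where r = recip (G /𝕥)

  Li⟨u⟩₀≈0 : ∀ k → (Li k ⟨ u ⟩) 0 ≈ 0#
  Li⟨u⟩₀≈0 k = trans (+-identityʳ _) (zeroˡ 1#)

  -- Exhibits the difference as the coefficient of a product whose second factor generates the
  -- `bernoulli₂` values at x.
  ΔpolyBernoulli₂ : ∀ k n x → polyBernoulli₂ k n (x + 1#) - polyBernoulli₂ k n x
    ≈ egfCoefficient (Li k ⟨ u ⟩ ⊛ (𝕥 ⊘ log[1+t] ⊛ [1+t]^ x)) n
  ΔpolyBernoulli₂ k n x = begin
    polyBernoulli₂ k n (x + 1#) - polyBernoulli₂ k n x
      ≈⟨ egfCoefficient-⊖ (Q ⊛ [1+t]^ (x + 1#)) (Q ⊛ [1+t]^ x) n ⟩
    f * ((Q ⊛ [1+t]^ (x + 1#)) n - (Q ⊛ [1+t]^ x) n)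
      ≈⟨ *-congˡ (⊛-distribˡ-⊖ Q ([1+t]^ (x + 1#)) ([1+t]^ x) n) ⟨
    f * (Q ⊛ ([1+t]^ (x + 1#) ⊖ [1+t]^ x)) n
      ≈⟨ *-congˡ (⊛-congˡ Q (Δ[1+t]^ x) n) ⟩
    f * (Q ⊛ (𝕥 ⊛ [1+t]^ x)) n
      ≈⟨ *-congˡ (⊘-⊛𝕥⊛ (Li k ⟨ u ⟩) log[1+t] ([1+t]^ x) (Li⟨u⟩₀≈0 k) n) ⟩
    egfCoefficient (Li k ⟨ u ⟩ ⊛ (𝕥 ⊘ log[1+t] ⊛ [1+t]^ x)) n ∎
    where
    f = ι (ℕ→ℚ (n !))
    Q = Li k ⟨ u ⟩ ⊘ log[1+t]

  sum₀≈sum₁ : ∀ n {f : ℕ → Carrier} → f 0 ≈ 0# → sum₀ n f ≈ ∑[ i from1to n ] f i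
  sum₀≈sum₁ n f₀≈0 = trans (+-congʳ f₀≈0) (+-identityˡ _)

-- The product rule and the resulting double sum.

theorem3 : ∀ {c ℓ} (A : ℚ-Algebra c ℓ) (S₂ : ℕ → ℕ → ℚ) → IsStirling₂ S₂ →
    let open PolyBernoulli A in
    (k : ℤ) (n : ℕ) → 1 ≤ n → (x : Carrier) →
    polyBernoulli₂ k n (x + 1#) - polyBernoulli₂ k n x
    ≈ ∑[ p from1to n ] ∑[ m from1to p ]
    ι (ℕ→ℚ (n C p) *ℚ (sign (m +ℕ p) *ℚ ℕ→ℚ (m !) *ℚ 1/ m ^ k) *ℚ S₂ p m) * bernoulli₂ (n ∸ p) x
theorem3 A S₂ isS₂ k n _ x = begin
  polyBernoulli₂ k n (x + 1#) - polyBernoulli₂ k n x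
    ≈⟨ ΔpolyBernoulli₂ k n x ⟩
  n!′ * sum₀ n (λ p → L p * G (n ∸ p))
    -- Liₖ(u) has no constant term, so p starts at 1.
    ≈⟨ *-congˡ (sum₀≈sum₁ n {λ p → L p * G (n ∸ p)} (trans (*-congʳ (Li⟨u⟩₀≈0 k)) (zeroˡ _))) ⟩
  n!′ * (∑[ p from1to n ] L p * G (n ∸ p))
    ≈⟨ *-distribˡ-sum {n} n!′ (λ i → L (suc (toℕ i)) * G (n ∸ suc (toℕ i))) ⟩
  (∑[ p from1to n ] n!′ * (L p * G (n ∸ p)))
    -- `toℕ<n i` is literally `suc (toℕ i) ≤ n`, the bound on the shifted index p.
    ≈⟨ sum-cong-≋ {n} (λ i → row-form (suc (toℕ i)) (toℕ<n i)) ⟩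
  (∑[ p from1to n ] ∑[ m from1to p ] term p m) ∎
  where
  open PolyBernoulli A
  open PolyBernoulliProperties A
  open IsRingHomomorphism ι-isRingHomomorphism using (*-homo)
  open NaturalCoefficients commutativeSemiring using (solve; _:*_; _:=_)
  open Relation.Binary.Reasoning.Setoid setoid

  n!′ = ι (ℕ→ℚ (n !))
  L   = Li k ⟨ u ⟩
  G   = 𝕥 ⊘ log[1+t] ⊛ [1+t]^ x

  term : ∀ p m .{{_ : NonZero m}} → Carrier
  term p m = ι (ℕ→ℚ (n C p) *ℚ (sign (m +ℕ p) *ℚ ℕ→ℚ (m !) *ℚ 1/ m ^ k) *ℚ S₂ p m) * bernoulli₂ (n ∸ p) x

  -- Splitting n! gives p! to uᵐ and (n - p)! to the Bernoulli factor. The bound by n is for the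
  -- binomial coefficient, the bound by p for comparing Stirling numbers.
  term-form : ∀ p m → suc m ≤ p → p ≤ n →
    n!′ * (ι (1/ suc m ^ k) * (u ⊛^ suc m) p * G (n ∸ p)) ≈ term p (suc m)
  term-form p m′ m≤p p≤n = begin
    n!′ * (i * U * g)
      ≈⟨ *-congʳ (trans (ι-cong (n!≡nCp*p!*[n-p]! p≤n)) (trans (*-homo _ _) (*-congˡ (*-homo _ _)))) ⟩
    ι (ℕ→ℚ (n C p)) * (ι (ℕ→ℚ (p !)) * ι (ℕ→ℚ ((n ∸ p) !))) * (i * U * g)
      ≈⟨ solve 6 (λ c f h i U g → c :* (f :* h) :* (i :* U :* g) := c :* (f :* U :* i) :* (h :* g))
           refl (ι (ℕ→ℚ (n C p))) (ι (ℕ→ℚ (p !))) (ι (ℕ→ℚ ((n ∸ p) !))) i U g ⟩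
    ι (ℕ→ℚ (n C p)) * (egfCoefficient (u ⊛^ m) p * i) * bernoulli₂ (n ∸ p) x
      ≈⟨ *-congʳ (*-congˡ (*-congʳ (egfCoefficient-u⊛^ m p))) ⟩
    ι (ℕ→ℚ (n C p)) * (ι (coeff m p) * i) * bernoulli₂ (n ∸ p) x
      ≈⟨ *-congʳ (trans (*-homo _ _) (*-congˡ (*-homo _ _))) ⟨
    ι (ℕ→ℚ (n C p) *ℚ (coeff m p *ℚ 1/ m ^ k)) * bernoulli₂ (n ∸ p) x
      -- `coeff` is built on `stirling₂`; its product with m! is exchanged here for that of the
      -- given `S₂`.
      ≈⟨ *-congʳ (ι-cong (cong (λ a → ℕ→ℚ (n C p) *ℚ (sign (m +ℕ p) *ℚ a *ℚ 1/ m ^ k)) (l!*stirling₂ S₂ isS₂ m≤p))) ⟩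
    ι (ℕ→ℚ (n C p) *ℚ (sign (m +ℕ p) *ℚ (ℕ→ℚ (m !) *ℚ S₂ p m) *ℚ 1/ m ^ k)) * bernoulli₂ (n ∸ p) x
      ≈⟨ *-congʳ (ι-cong (ℚ-solve 5 (λ c s f S i → c ∙ (s ∙ (f ∙ S) ∙ i) ≗ c ∙ (s ∙ f ∙ i) ∙ S) ≡.refl
           (ℕ→ℚ (n C p)) (sign (m +ℕ p)) (ℕ→ℚ (m !)) (S₂ p m) (1/ m ^ k))) ⟩
    term p m ∎
    where
    open +-*-Solver using () renaming (solve to ℚ-solve; _:*_ to _∙_; _:=_ to _≗_)
    m = suc m′
    i = ι (1/ m ^ k)
    U = (u ⊛^ m) p
    g = G (n ∸ p)

  row-form : ∀ p → p ≤ n → n!′ * (L p * G (n ∸ p)) ≈ ∑[ m from1to p ] term p m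
  row-form p p≤n = begin
    n!′ * (L p * g)
      -- Composition truncates the coefficient of tᵖ at m = p, and `Li k 0` is zero, so m runs from
      -- 1 to p.
      ≈⟨ *-congˡ (*-congʳ (sum₀≈sum₁ p {λ m → Li k m * (u ⊛^ m) p} (zeroˡ _))) ⟩
    n!′ * ((∑[ m from1to p ] Li k m * (u ⊛^ m) p) * g)
      ≈⟨ *-congˡ (*-distribʳ-sum {p} g (λ i → Li k (suc (toℕ i)) * (u ⊛^ suc (toℕ i)) p)) ⟩
    n!′ * (∑[ m from1to p ] Li k m * (u ⊛^ m) p * g)
      ≈⟨ *-distribˡ-sum {p} n!′ (λ i → Li k (suc (toℕ i)) * (u ⊛^ suc (toℕ i)) p * g) ⟩
    (∑[ m from1to p ] n!′ * (Li k m * (u ⊛^ m) p * g))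
      ≈⟨ sum-cong-≋ {p} (λ i → term-form p (toℕ i) (toℕ<n i) p≤n) ⟩
    (∑[ m from1to p ] term p m) ∎
    where g = G (n ∸ p)
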